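{- Let $\epsilon=\epsilon_1\cdots\epsilon_n$ be a sequence and let $\epsilon'$ be the sequence obtained by applying Algorithm A (described below) to $\epsilon$. Then $\operatorname{Em}(p,\epsilon)=\operatorname{Em}(q,\epsilon')$ and $\operatorname{Em}(q,\epsilon)=\operatorname{Em}(p,\epsilon')$; that is, the algorithm exchanges the occurrences of $p=\underline{0102}$ and $q=\underline{0112}$.
   Context: The reduction of an integer word replaces each occurrence of its $k$-th smallest distinct value by $k-1$; a consecutive pattern $\underline{p_1p_2p_3p_4}$ occurs in a sequence at position $i$ if the reduction of its entries in positions $i,\dots,i+3$ equals $p_1p_2p_3p_4$, and $\operatorname{Em}(p,\epsilon)$ denotes the set of positions of occurrences of $p$ in $\epsilon$. Let $p=\underline{0102}$ and $q=\underline{0112}$. Algorithm A, on input an integer sequence $\mathrm{seq}=\epsilon_1\cdots\epsilon_n$: let $E_p$, $E_q$ be the sets of positions of occurrences of $p$, resp. $q$, in the input sequence; set $\mathrm{last}:=$ null. For $i=1,2,\dots,n$ in order: let $N_p,N_q$ be the sets of positions of occurrences of $p$, resp. $q$, in the current sequence. If $i-2\in E_p$: set $\mathrm{last}:=\mathrm{seq}[i]$ and $\mathrm{seq}[i]:=\mathrm{seq}[i-1]$. Else if $i-2\in E_q$: set $\mathrm{last}:=\mathrm{seq}[i]$ and $\mathrm{seq}[i]:=\mathrm{seq}[i-2]$. Else if $i-2\in N_p$ or $i-2\in N_q$: swap the values of $\mathrm{seq}[i]$ and $\mathrm{last}$. Output $\mathrm{seq}$. -}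

module Defs where

open import Data.Bool.Base using (if_then_else_)
open import Data.Fin.Base using (Fin; zero; suc; toℕ; pred)
open import Data.Integer.Base using (ℤ)
open import Data.Integer.Properties using (_≟_; _<?_)
open import Data.List.Base
  using (List; []; _∷_; length; map; filter; deduplicate; take; drop; foldl; allFin)
open import Data.List.Properties using (≡-dec)
open import Data.Maybe.Base as Maybe using (Maybe; just; nothing; _>>=_)
import Data.Nat.Properties as ℕ
open import Data.Nat.Base using (ℕ)
open import Data.Vec.Base using (Vec; toList; lookup; _[_]≔_)
open import Level using (0ℓ)
open import Relation.Binary.PropositionalEquality using (_≡_)
open import Relation.Nullary.Decidable using (does; _⊎-dec_)
open import Relation.Unary using (Pred; Decidable)

-- x is the k-th smallest distinct value of w exactly when k - 1 distinct
-- values of w are smaller than x.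
reduction : List ℤ → List ℕ
reduction w = map (λ x → length (filter (_<? x) (deduplicate _≟_ w))) w

-- Positions are counted from 0.  A window running past the end of the
-- sequence is shorter than the pattern, so it is never an occurrence.
Em : ∀ {n} → List ℕ → Vec ℤ n → Pred ℕ 0ℓ
Em π ε i = reduction (take (length π) (drop i (toList ε))) ≡ π

Em? : ∀ {n} (π : List ℕ) (ε : Vec ℤ n) → Decidable (Em π ε)
Em? π ε i = ≡-dec ℕ._≟_ (reduction (take (length π) (drop i (toList ε)))) π

p q : List ℕ
p = 0 ∷ 1 ∷ 0 ∷ 2 ∷ []
q = 0 ∷ 1 ∷ 1 ∷ 2 ∷ []

-- The value nothing of last stands for null.
record State (n : ℕ) : Set where
  constructor mkState
  field
    seq  : Vec ℤ n
    last : Maybe ℤ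

-- One iteration of the loop, where ε is the original input.  For the first
-- two indices i - 2 is not a position, so nothing is done.  Swapping with a
-- null last would put null into the sequence; the result is then nothing.
step : ∀ {n} → Vec ℤ n → Fin n → State n → Maybe (State n)
step ε zero            s = just s
step ε (suc zero)      s = just s
step ε i@(suc (suc j)) (mkState seq last) =
  if does (Em? p ε i-2)
    then just (mkState (seq [ i ]≔ lookup seq (pred i)) (just (lookup seq i)))
  else if does (Em? q ε i-2)
    then just (mkState (seq [ i ]≔ lookup seq (pred (pred i))) (just (lookup seq i)))
  else if does (Em? p seq i-2 ⊎-dec Em? q seq i-2)
    then Maybe.map (λ x → mkState (seq [ i ]≔ x) (just (lookup seq i))) last
  else just (mkState seq last)
  where
  i-2 = toℕ j

algorithmA : ∀ {n} → Vec ℤ n → Maybe (Vec ℤ n)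
algorithmA {n} ε =
  Maybe.map State.seq
    (foldl (λ s i → s >>= step ε i) (just (mkState ε nothing)) (allFin n))

{-# OPTIONS --safe #-}
module Submission where

-- Replacing the third entry turns abac into abbc and back, for a < b < c.  This may only disturb
-- the window that starts at the replaced entry: the other windows through it still
-- have the wrong order type, because both the old and the new value are at most
-- the left neighbour b, and b is below the right neighbour c.  A disturbed window that
-- becomes an occurrence reads a′ b a′ c with original a b a′ c, a ≠ a′, a < b, and last
-- still holds a; the swap makes it a′ b a c, which is no occurrence.

open import Defs
open import Data.Fin.Base using (Fin; zero; suc; toℕ; inject₁)
open import Data.Fin.Properties using (toℕ-inject₁)
open import Data.Integer.Base using (ℤ; 0ℤ; _<_; _≤_)
import Data.Integer.Properties as ℤ
open import Data.List.Base using (List; []; _∷_; length; filter; deduplicate; take; drop; foldl; tabulate; allFin)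
open import Data.List.Membership.Propositional using (_∈_)
open import Data.List.Membership.Propositional.Properties using (∈-deduplicate⁺)
open import Data.List.Properties using (∷-injective; length-map)
open import Data.List.Relation.Binary.Sublist.Propositional using (⊆-refl)
open import Data.List.Relation.Binary.Sublist.Propositional.Properties using (filter⁺; length-mono-≤)
open import Data.List.Relation.Unary.Any using (here; there)
open import Data.Maybe.Base as Maybe using (just; nothing; _>>=_)
open import Data.Nat.Base as ℕ using (ℕ; zero; suc; _+_; s≤s; z≤n)
import Data.Nat.Properties as ℕ
open import Data.Product.Base using (∃-syntax; _×_; _,_; proj₁; proj₂)
open import Data.Sum.Base using (_⊎_; inj₁; inj₂; [_,_]′)
open import Data.Vec.Base using (Vec; []; _∷_; toList; lookup; _[_]≔_)
open import Data.Sum.Function.Propositional using (_⊎-⇔_)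
open import Function.Base using (_∘_; id)
open import Function.Bundles using (_⇔_; mk⇔; module Equivalence)
open import Relation.Binary.Definitions using (tri<; tri≈; tri>)
open import Relation.Binary.PropositionalEquality
  using (_≡_; _≢_; refl; sym; trans; cong; cong₂; subst; subst₂)
open import Relation.Nullary.Decidable using (Dec; yes; no; dec-true; dec-false; _×-dec_; _⊎-dec_)
open import Relation.Nullary.Negation using (¬_; contradiction)
open import Relation.Unary using (_≐_)

open Equivalence using (to; from)

-- Ranks and the order of values.

rank : List ℤ → ℤ → ℕ
rank w x = length (filter (ℤ._<? x) (deduplicate ℤ._≟_ w))

-- Everything below `x` is also below `y`, and `x` itself is counted only on the right.
length-filter-< : ∀ {x y xs} → x ∈ xs → x < y →
  length (filter (ℤ._<? x) xs) ℕ.< length (filter (ℤ._<? y) xs)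
length-filter-< {x} {y} {z ∷ zs} (here refl) x<y
  rewrite dec-false (z ℤ.<? z) (ℤ.<-irrefl refl) | dec-true (z ℤ.<? y) x<y =
  s≤s (length-mono-≤ (filter⁺ (ℤ._<? z) (ℤ._<? y) (λ { refl a<z → ℤ.<-trans a<z x<y }) (⊆-refl {x = zs})))
length-filter-< {x} {y} {z ∷ zs} (there x∈zs) x<y with z ℤ.<? x | z ℤ.<? y
... | yes z<x | no z≮y = contradiction (ℤ.<-trans z<x x<y) z≮y
... | yes _   | yes _  = s≤s (length-filter-< x∈zs x<y)
... | no _    | yes _  = ℕ.m<n⇒m<1+n (length-filter-< x∈zs x<y)
... | no _    | no _   = length-filter-< x∈zs x<y

rank-< : ∀ {w x y} → x ∈ w → x < y → rank w x ℕ.< rank w y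
rank-< x∈w = length-filter-< (∈-deduplicate⁺ ℤ._≟_ x∈w)

rank-cancel-< : ∀ {w x y} → y ∈ w → rank w x ℕ.< rank w y → x < y
rank-cancel-< {w} {x} {y} y∈w r with ℤ.<-cmp x y
... | tri< x<y _ _  = x<y
... | tri≈ _ refl _ = contradiction r (ℕ.<-irrefl refl)
... | tri> _ _ y<x  = contradiction r (ℕ.<-asym (rank-< y∈w y<x))

rank-injective : ∀ {w x y} → x ∈ w → y ∈ w → rank w x ≡ rank w y → x ≡ y
rank-injective {w} {x} {y} x∈w y∈w r with ℤ.<-cmp x y
... | tri< x<y _ _ = contradiction r (ℕ.<⇒≢ (rank-< x∈w x<y))
... | tri≈ _ x≡y _ = x≡y
... | tri> _ _ y<x = contradiction (sym r) (ℕ.<⇒≢ (rank-< y∈w y<x))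

-- The two patterns as order conditions.

Is0102 Is0112 : ℤ → ℤ → ℤ → ℤ → Set
Is0102 x y z w = x < y × y < w × z ≡ x
Is0112 x y z w = x < y × y < w × z ≡ y

reduction-injective : ∀ {x y z w i j k l} →
  reduction (x ∷ y ∷ z ∷ w ∷ []) ≡ i ∷ j ∷ k ∷ l ∷ [] →
  let r = rank (x ∷ y ∷ z ∷ w ∷ []) in r x ≡ i × r y ≡ j × r z ≡ k × r w ≡ l
reduction-injective eq with ∷-injective eq
... | rx , eq₁ with ∷-injective eq₁
... | ry , eq₂ with ∷-injective eq₂
... | rz , eq₃ = rx , ry , rz , proj₁ (∷-injective eq₃)

-- Both patterns have the same three distinct values in the same order, so one computation serves
-- both.
ranks : ∀ {u x y w} → x < y → y < w → deduplicate ℤ._≟_ u ≡ x ∷ y ∷ w ∷ [] →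
  rank u x ≡ 0 × rank u y ≡ 1 × rank u w ≡ 2
ranks {x = x} {y} {w} x<y y<w eq rewrite eq
  | dec-false (x ℤ.<? x) (ℤ.<-irrefl refl)
  | dec-false (y ℤ.<? x) (ℤ.<-asym x<y)
  | dec-false (w ℤ.<? x) (ℤ.<-asym (ℤ.<-trans x<y y<w))
  | dec-true  (x ℤ.<? y) x<y
  | dec-false (y ℤ.<? y) (ℤ.<-irrefl refl)
  | dec-false (w ℤ.<? y) (ℤ.<-asym y<w)
  | dec-true  (x ℤ.<? w) (ℤ.<-trans x<y y<w)
  | dec-true  (y ℤ.<? w) y<w
  | dec-false (w ℤ.<? w) (ℤ.<-irrefl refl)
  = refl , refl , refl

deduplicate-0102 : ∀ {x y w} → x < y → y < w →
  deduplicate ℤ._≟_ (x ∷ y ∷ x ∷ w ∷ []) ≡ x ∷ y ∷ w ∷ []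
deduplicate-0102 {x} {y} {w} x<y y<w
  -- The rewrites follow the nested filters from the inside out; a comparison recurs when an outer
  -- filter reaches the same pair.
  rewrite dec-false (x ℤ.≟ w) (ℤ.<⇒≢ (ℤ.<-trans x<y y<w))
  | dec-false (y ℤ.≟ x) (ℤ.<⇒≢ x<y ∘ sym)
  | dec-false (y ℤ.≟ w) (ℤ.<⇒≢ y<w)
  | dec-false (x ℤ.≟ y) (ℤ.<⇒≢ x<y)
  | dec-true  (x ℤ.≟ x) refl
  | dec-false (x ℤ.≟ w) (ℤ.<⇒≢ (ℤ.<-trans x<y y<w))
  = refl

deduplicate-0112 : ∀ {x y w} → x < y → y < w →
  deduplicate ℤ._≟_ (x ∷ y ∷ y ∷ w ∷ []) ≡ x ∷ y ∷ w ∷ []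
deduplicate-0112 {x} {y} {w} x<y y<w
  rewrite dec-false (y ℤ.≟ w) (ℤ.<⇒≢ y<w)
  | dec-true  (y ℤ.≟ y) refl
  | dec-false (y ℤ.≟ w) (ℤ.<⇒≢ y<w)
  | dec-false (x ℤ.≟ y) (ℤ.<⇒≢ x<y)
  | dec-false (x ℤ.≟ w) (ℤ.<⇒≢ (ℤ.<-trans x<y y<w))
  = refl

module _ (x y z w : ℤ) where

  private
    u : List ℤ
    u = x ∷ y ∷ z ∷ w ∷ []

    x∈u : x ∈ u
    x∈u = here refl
    y∈u : y ∈ u
    y∈u = there (here refl)
    z∈u : z ∈ u
    z∈u = there (there (here refl))
    w∈u : w ∈ u
    w∈u = there (there (there (here refl)))

    rises : rank u x ≡ 0 → rank u y ≡ 1 → rank u w ≡ 2 → x < y × y < w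
    rises rx ry rw = rank-cancel-< y∈u (subst₂ ℕ._<_ (sym rx) (sym ry) (ℕ.n<1+n 0))
                   , rank-cancel-< w∈u (subst₂ ℕ._<_ (sym ry) (sym rw) (ℕ.n<1+n 1))

  reduction≡p : reduction u ≡ p ⇔ Is0102 x y z w
  reduction≡p = mk⇔ ⇒ ⇐
    where
    ⇒ : reduction u ≡ p → Is0102 x y z w
    ⇒ eq with reduction-injective {x} {y} {z} {w} eq
    ... | rx , ry , rz , rw with rises rx ry rw
    ... | x<y , y<w = x<y , y<w , rank-injective z∈u x∈u (trans rz (sym rx))
    ⇐ : Is0102 x y z w → reduction u ≡ p
    ⇐ (x<y , y<w , refl) with ranks {u} x<y y<w (deduplicate-0102 x<y y<w)
    ... | rx , ry , rw = cong₂ _∷_ rx (cong₂ _∷_ ry (cong₂ _∷_ rx (cong (_∷ []) rw)))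

  reduction≡q : reduction u ≡ q ⇔ Is0112 x y z w
  reduction≡q = mk⇔ ⇒ ⇐
    where
    ⇒ : reduction u ≡ q → Is0112 x y z w
    ⇒ eq with reduction-injective {x} {y} {z} {w} eq
    ... | rx , ry , rz , rw with rises rx ry rw
    ... | x<y , y<w = x<y , y<w , rank-injective z∈u y∈u (trans rz (sym ry))
    ⇐ : Is0112 x y z w → reduction u ≡ q
    ⇐ (x<y , y<w , refl) with ranks {u} x<y y<w (deduplicate-0112 x<y y<w)
    ... | rx , ry , rw = cong₂ _∷_ rx (cong₂ _∷_ ry (cong₂ _∷_ ry (cong (_∷ []) rw)))

-- Windows of a sequence.

-- Past the end of the vector the entry is the junk value 0.
_‼_ : ∀ {n} → Vec ℤ n → ℕ → ℤ
[]       ‼ _     = 0ℤ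
(x ∷ _)  ‼ zero  = x
(_ ∷ xs) ‼ suc k = xs ‼ k

lookup-‼ : ∀ {n} (xs : Vec ℤ n) i → lookup xs i ≡ xs ‼ toℕ i
lookup-‼ (_ ∷ _)  zero    = refl
lookup-‼ (_ ∷ xs) (suc i) = lookup-‼ xs i

‼-updated : ∀ {n} (xs : Vec ℤ n) i {x} → (xs [ i ]≔ x) ‼ toℕ i ≡ x
‼-updated (_ ∷ _)  zero    = refl
‼-updated (_ ∷ xs) (suc i) = ‼-updated xs i

‼-minimal : ∀ {n} (xs : Vec ℤ n) i {x} k → k ≢ toℕ i → (xs [ i ]≔ x) ‼ k ≡ xs ‼ k
‼-minimal (_ ∷ _)  zero    zero    k≢i = contradiction refl k≢i
‼-minimal (_ ∷ _)  zero    (suc k) k≢i = refl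
‼-minimal (_ ∷ _)  (suc i) zero    k≢i = refl
‼-minimal (_ ∷ xs) (suc i) (suc k) k≢i = ‼-minimal xs i k (k≢i ∘ cong suc)

window-fits : ∀ {n} (xs : Vec ℤ n) j → length (take 4 (drop j (toList xs))) ≡ 4 → 4 + j ℕ.≤ n
window-fits []                  zero    ()
window-fits (_ ∷ [])            zero    ()
window-fits (_ ∷ _ ∷ [])        zero    ()
window-fits (_ ∷ _ ∷ _ ∷ [])    zero    ()
window-fits (_ ∷ _ ∷ _ ∷ _ ∷ _) zero    _  = s≤s (s≤s (s≤s (s≤s z≤n)))
window-fits []                  (suc j) ()
window-fits (_ ∷ xs)            (suc j) eq = s≤s (window-fits xs j eq)

window : ∀ {n} (xs : Vec ℤ n) j → 4 + j ℕ.≤ n →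
  take 4 (drop j (toList xs)) ≡ xs ‼ j ∷ xs ‼ (1 + j) ∷ xs ‼ (2 + j) ∷ xs ‼ (3 + j) ∷ []
window (_ ∷ _ ∷ [])        zero    (s≤s (s≤s ()))
window (_ ∷ _ ∷ _ ∷ [])    zero    (s≤s (s≤s (s≤s ())))
window (_ ∷ _ ∷ _ ∷ _ ∷ _) zero    (s≤s (s≤s (s≤s (s≤s _)))) = refl
window (_ ∷ xs)            (suc j) (s≤s fits)                  = window xs j fits

-- Stated for functions, so that it also applies to the recursive description of the output. The
-- bound keeps junk entries from imitating a pattern.
Occurs : (ℤ → ℤ → ℤ → ℤ → Set) → ℕ → (ℕ → ℤ) → ℕ → Set
Occurs A n f j = 4 + j ℕ.≤ n × A (f j) (f (1 + j)) (f (2 + j)) (f (3 + j))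

Em⇔Occurs : ∀ {n A a b c d} →
  (∀ x y z w → reduction (x ∷ y ∷ z ∷ w ∷ []) ≡ a ∷ b ∷ c ∷ d ∷ [] ⇔ A x y z w) →
  (ε : Vec ℤ n) (j : ℕ) → Em (a ∷ b ∷ c ∷ d ∷ []) ε j ⇔ Occurs A n (ε ‼_) j
Em⇔Occurs {n} {A} {a} {b} {c} {d} spec ε j = mk⇔ ⇒ ⇐
  where
  w = take 4 (drop j (toList ε))
  ⇒ : reduction w ≡ a ∷ b ∷ c ∷ d ∷ [] → Occurs A n (ε ‼_) j
  ⇒ eq with fits ← window-fits ε j (trans (sym (length-map _ w)) (cong length eq)) =
    fits , to (spec _ _ _ _) (trans (cong reduction (sym (window ε j fits))) eq)
  ⇐ : Occurs A n (ε ‼_) j → reduction w ≡ a ∷ b ∷ c ∷ d ∷ []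
  ⇐ (fits , occ) = trans (cong reduction (window ε j fits)) (from (spec _ _ _ _) occ)

Em-p : ∀ {n} (ε : Vec ℤ n) j → Em p ε j ⇔ Occurs Is0102 n (ε ‼_) j
Em-p = Em⇔Occurs reduction≡p

Em-q : ∀ {n} (ε : Vec ℤ n) j → Em q ε j ⇔ Occurs Is0112 n (ε ‼_) j
Em-q = Em⇔Occurs reduction≡q

Occurs? : ∀ {A} → (∀ x y z w → Dec (A x y z w)) → ∀ n f j → Dec (Occurs A n f j)
Occurs? A? n f j = 4 + j ℕ.≤? n ×-dec A? (f j) (f (1 + j)) (f (2 + j)) (f (3 + j))

Is0102? : ∀ x y z w → Dec (Is0102 x y z w)
Is0102? x y z w = x ℤ.<? y ×-dec y ℤ.<? w ×-dec z ℤ.≟ x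

Is0112? : ∀ x y z w → Dec (Is0112 x y z w)
Is0112? x y z w = x ℤ.<? y ×-dec y ℤ.<? w ×-dec z ℤ.≟ y

-- The output as a recursion.

module Output (n : ℕ) (e : ℕ → ℤ) where

  P Q : (ℕ → ℤ) → ℕ → Set
  P = Occurs Is0102 n
  Q = Occurs Is0112 n

  P? : ∀ f j → Dec (P f j)
  P? = Occurs? Is0102? n

  Q? : ∀ f j → Dec (Q f j)
  Q? = Occurs? Is0112? n

  -- When position 2 + j is treated, the entries from there on are still original.
  N : ℕ → ℤ → ℤ → Set
  N j x y = (4 + j ℕ.≤ n × Is0102 x y (e (2 + j)) (e (3 + j)))
          ⊎ (4 + j ℕ.≤ n × Is0112 x y (e (2 + j)) (e (3 + j)))

  N? : ∀ j x y → Dec (N j x y)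
  N? j x y = (4 + j ℕ.≤? n ×-dec Is0102? x y (e (2 + j)) (e (3 + j)))
      ⊎-dec (4 + j ℕ.≤? n ×-dec Is0112? x y (e (2 + j)) (e (3 + j)))

  -- The value of last at a swap is claimed to be the original entry two places
  -- to the left, which makes the output a recursion without last.
  next : ℕ → ℤ → ℤ → ℤ
  next j x y with P? e j | Q? e j | N? j x y
  ... | yes _ | _     | _     = y
  ... | no _  | yes _ | _     = x
  ... | no _  | no _  | yes _ = e j
  ... | no _  | no _  | no _  = e (2 + j)

  σ : ℕ → ℤ
  σ (suc (suc j)) = next j (σ j) (σ (suc j))
  σ i             = e i

  -- A view of one iteration: each case carries the outcomes of the tests that led to it and the
  -- value written.
  data Branch (j : ℕ) (x y z : ℤ) : Set where
    atP  : P e j → z ≡ y → Branch j x y z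
    atQ  : ¬ P e j → Q e j → z ≡ x → Branch j x y z
    swap : ¬ P e j → ¬ Q e j → N j x y → z ≡ e j → Branch j x y z
    keep : ¬ P e j → ¬ Q e j → ¬ N j x y → z ≡ e (2 + j) → Branch j x y z

  branch-next : ∀ j x y → Branch j x y (next j x y)
  branch-next j x y with P? e j | Q? e j | N? j x y
  ... | yes Pe | _      | _      = atP Pe refl
  ... | no ¬Pe | yes Qe | _      = atQ ¬Pe Qe refl
  ... | no ¬Pe | no ¬Qe | yes Nj = swap ¬Pe ¬Qe Nj refl
  ... | no ¬Pe | no ¬Qe | no ¬Nj = keep ¬Pe ¬Qe ¬Nj refl

  branch : ∀ j → Branch j (σ j) (σ (1 + j)) (σ (2 + j))
  branch j = branch-next j (σ j) (σ (1 + j))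

  -- Entries that move and entries that stay.

  -- A moved entry and its original both lie at or below the left neighbour, which
  -- lies below the right one; so the two neighbours of a moved entry are not moved.
  data Local : ℕ → Set where
    same  : ∀ {i} → σ i ≡ e i → Local i
    moved : ∀ {i} → σ i ≡ e i → σ (1 + i) ≤ e i → e (1 + i) ≤ e i → e i < e (2 + i) → Local (1 + i)

  fixed-if-e-rises : ∀ {i} → Local (1 + i) → e i < e (1 + i) → σ (1 + i) ≡ e (1 + i)
  fixed-if-e-rises (same eq)           _ = eq
  fixed-if-e-rises (moved _ _ e≤e _) e<e = contradiction e≤e (ℤ.<⇒≱ e<e)

  fixed-if-σ-rises : ∀ {i} → Local (1 + i) → σ i < σ (1 + i) → σ (1 + i) ≡ e (1 + i)
  fixed-if-σ-rises (same eq)            _ = eq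
  fixed-if-σ-rises (moved eq σ≤e _ _) σ<σ =
    contradiction (ℤ.≤-trans σ≤e (ℤ.≤-reflexive (sym eq))) (ℤ.<⇒≱ σ<σ)

  -- If `j` was moved, its new value is at most the left neighbour, which is below the right one.
  σ-below : ∀ {j} → Local j → e j < e (1 + j) → σ j < e (1 + j)
  σ-below (same eq)            e<e = subst (_< _) (sym eq) e<e
  σ-below (moved _ σ≤e _ e<e′) _   = ℤ.≤-<-trans σ≤e e<e′

  N-rises : ∀ {j x y} → N j x y → x < y × y < e (3 + j)
  N-rises (inj₁ (_ , x<y , y<w , _)) = x<y , y<w
  N-rises (inj₂ (_ , x<y , y<w , _)) = x<y , y<w

  N⇒E : ∀ {j x y} → N j x y → x ≡ e j → y ≡ e (1 + j) → P e j ⊎ Q e j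
  N⇒E Nj refl refl = Nj

  -- The window is no occurrence in the input, so one of its first two entries has changed; the rise
  -- between them shows that it is the first. A 0112 window would then already be one in the input,
  -- because `e j < e (1 + j)`; hence the third entry repeats `σ j`.
  swap-moved : ∀ {j} → Local j → Local (1 + j) → ¬ P e j → ¬ Q e j → N j (σ j) (σ (1 + j)) →
    σ j < e (1 + j) × e j < e (1 + j) × e (2 + j) ≡ σ j × σ j ≢ e j
  swap-moved {j} l l′ ¬Pe ¬Qe Nj with fixed-if-σ-rises l′ (proj₁ (N-rises Nj))
  swap-moved (same eq) l′ ¬Pe ¬Qe Nj | eq′ = contradiction (N⇒E Nj eq eq′) [ ¬Pe , ¬Qe ]′
  swap-moved {j} (moved eq σ≤e e≤e e<e) l′ ¬Pe ¬Qe Nj | eq′ = σj< , ej< , third Nj , fourth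
    where
    σj< : σ j < e (1 + j)
    σj< = ℤ.≤-<-trans σ≤e e<e
    ej< : e j < e (1 + j)
    ej< = ℤ.≤-<-trans e≤e e<e
    third : N j (σ j) (σ (1 + j)) → e (2 + j) ≡ σ j
    third (inj₁ (_ , _ , _ , z≡x)) = z≡x
    third (inj₂ (fits , _ , y<w , z≡y)) =
      contradiction (fits , ej< , subst (_< _) eq′ y<w , trans z≡y eq′) ¬Qe
    fourth : σ j ≢ e j
    fourth eq = [ ¬Pe , ¬Qe ]′ (N⇒E Nj eq eq′)

  local-step : ∀ {j} → Local j → Local (1 + j) → Local (2 + j)
  local-step {j} l l′ with branch j
  ... | keep _ _ _ z≡ = same z≡
  ... | atP (_ , x<y , y<w , c≡) z≡ =
    moved eq (ℤ.≤-reflexive (trans z≡ eq)) (subst (_≤ e (1 + j)) (sym c≡) (ℤ.<⇒≤ x<y)) y<w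
    where eq = fixed-if-e-rises l′ x<y
  ... | atQ _ (_ , x<y , y<w , c≡) z≡ =
    moved eq (subst (_≤ e (1 + j)) (sym z≡) (ℤ.<⇒≤ (σ-below l x<y))) (ℤ.≤-reflexive c≡) y<w
    where eq = fixed-if-e-rises l′ x<y
  ... | swap ¬Pe ¬Qe Nj z≡ with swap-moved l l′ ¬Pe ¬Qe Nj
  ... | σj< , ej< , c≡ , _ =
    -- The swap writes `e j` and removes `σ j`, and both lie below `e (1 + j)`.
    moved eq (subst (_≤ _) (sym z≡) (ℤ.<⇒≤ ej<)) (subst (_≤ _) (sym c≡) (ℤ.<⇒≤ σj<))
      (subst (_< _) eq (proj₂ (N-rises Nj)))
    where eq = fixed-if-σ-rises l′ (proj₁ (N-rises Nj))

  local : ∀ i → Local i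
  local zero          = same refl
  local (suc zero)    = same refl
  local (suc (suc j)) = local-step (local j) (local (suc j))

  fixed : ∀ i → e i < e (1 + i) ⊎ σ i < σ (1 + i) → σ (1 + i) ≡ e (1 + i)
  fixed i = [ fixed-if-e-rises (local (1 + i)) , fixed-if-σ-rises (local (1 + i)) ]′

  -- Exchange of the occurrences.

  -- The rises of the input into the second and fourth entries keep both fixed. The first may have
  -- moved, but stays below the second.
  Pe⇒Qσ : ∀ j → P e j → Q σ j
  Pe⇒Qσ j Pe@(fits , x<y , y<w , c≡) with branch j
  ... | atQ ¬Pe _ _    = contradiction Pe ¬Pe
  ... | swap ¬Pe _ _ _ = contradiction Pe ¬Pe
  ... | keep ¬Pe _ _ _ = contradiction Pe ¬Pe
  ... | atP _ z≡ = fits , subst (σ j <_) (sym eq) (σ-below (local j) x<y)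
                        , subst₂ _<_ (sym eq) (sym (fixed (2 + j) (inj₁ c<w))) y<w , z≡
    where
    eq = fixed j (inj₁ x<y)
    c<w : e (2 + j) < e (3 + j)
    c<w = subst (_< e (3 + j)) (sym c≡) (ℤ.<-trans x<y y<w)

  -- As for `Pe⇒Qσ`, except that the third entry copies the current first entry `σ j`, which need
  -- not be `e j`.
  Qe⇒Pσ : ∀ j → Q e j → P σ j
  Qe⇒Pσ j Qe@(fits , x<y , y<w , c≡) with branch j
  ... | atP (_ , _ , _ , c≡′) _ = contradiction (trans (sym c≡′) c≡) (ℤ.<⇒≢ x<y)
  ... | swap _ ¬Qe _ _ = contradiction Qe ¬Qe
  ... | keep _ ¬Qe _ _ = contradiction Qe ¬Qe
  ... | atQ _ _ z≡ = fits , subst (σ j <_) (sym eq) (σ-below (local j) x<y)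
                        , subst₂ _<_ (sym eq) (sym (fixed (2 + j) (inj₁ c<w))) y<w , z≡
    where
    eq = fixed j (inj₁ x<y)
    c<w : e (2 + j) < e (3 + j)
    c<w = subst (_< e (3 + j)) (sym c≡) y<w

  -- A swap would give `e j ≡ e (1 + j)`, against `swap-moved`. With a kept third entry, the rise
  -- into the fourth makes that one original, so the test `N` would have succeeded.
  Qσ⇒Pe : ∀ j → Q σ j → P e j
  Qσ⇒Pe j (fits , x<y , y<w , c≡) with branch j
  ... | atP Pe _ = Pe
  ... | atQ _ _ z≡ = contradiction (trans (sym z≡) c≡) (ℤ.<⇒≢ x<y)
  ... | swap ¬Pe ¬Qe Nj z≡ = contradiction
    (trans (trans (sym z≡) c≡) (fixed j (inj₂ x<y)))
    (ℤ.<⇒≢ (proj₁ (proj₂ (swap-moved (local j) (local (1 + j)) ¬Pe ¬Qe Nj))))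
  ... | keep _ _ ¬Nj z≡ = contradiction
    (inj₂ (fits , x<y , subst (σ (1 + j) <_) (fixed (2 + j) (inj₂ c<w)) y<w , trans (sym z≡) c≡)) ¬Nj
    where
    c<w : σ (2 + j) < σ (3 + j)
    c<w = subst (_< σ (3 + j)) (sym c≡) y<w

  Pσ⇒Qe : ∀ j → P σ j → Q e j
  Pσ⇒Qe j (fits , x<y , y<w , c≡) with branch j
  ... | atP _ z≡ = contradiction (trans (sym c≡) z≡) (ℤ.<⇒≢ x<y)
  ... | atQ _ Qe _ = Qe
  -- After a swap the third entry is `e j`, which differs from the first entry `σ j`.
  ... | swap ¬Pe ¬Qe Nj z≡ = contradiction (trans (sym c≡) z≡)
    (proj₂ (proj₂ (proj₂ (swap-moved (local j) (local (1 + j)) ¬Pe ¬Qe Nj))))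
  ... | keep _ _ ¬Nj z≡ = contradiction
    (inj₁ (fits , x<y , subst (σ (1 + j) <_) (fixed (2 + j) (inj₂ c<w)) y<w , trans (sym z≡) c≡)) ¬Nj
    where
    c<w : σ (2 + j) < σ (3 + j)
    c<w = subst (_< σ (3 + j)) (sym c≡) (ℤ.<-trans x<y y<w)

-- The loop computes the recursion.

foldl-tabulate : ∀ {A B : Set} {n} (I : ℕ → B → Set) (f : B → A → B) (g : Fin n → A) →
  (∀ i {b} → I (toℕ i) b → I (suc (toℕ i)) (f b (g i))) →
  ∀ {b} → I 0 b → I n (foldl f b (tabulate g))
foldl-tabulate {n = zero}  I f g preserved I₀ = I₀
foldl-tabulate {n = suc n} I f g preserved I₀ =
  foldl-tabulate (I ∘ suc) f (g ∘ suc) (preserved ∘ suc) (preserved zero I₀)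

module Simulation {n : ℕ} (ε : Vec ℤ n) where

  open Output n (ε ‼_)

  record Inv (k : ℕ) (s : State n) : Set where
    open State s
    field
      done   : ∀ i → i ℕ.< k → seq ‼ i ≡ σ i
      todo   : ∀ i → k ℕ.≤ i → seq ‼ i ≡ ε ‼ i
      -- The bounds select the two positions treated most recently; a swap needs the original of the
      -- earlier one.
      recent : ∀ i → i ℕ.< k → k ℕ.≤ 2 + i → σ i ≡ ε ‼ i ⊎ last ≡ just (ε ‼ i)

  Inv-start : Inv 0 (mkState ε nothing)
  Inv-start = record { done = λ _ () ; todo = λ _ _ → refl ; recent = λ _ () }

  Inv-kept : ∀ {k s} → σ k ≡ ε ‼ k → Inv k s → Inv (suc k) s
  Inv-kept {k} {s} eq inv = record
    { done   = done′
    ; todo   = λ i k<i → todo i (ℕ.<⇒≤ k<i)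
    ; recent = recent′
    }
    where
    open State s
    open Inv inv
    done′ : ∀ i → i ℕ.< suc k → seq ‼ i ≡ σ i
    done′ i i<1+k with ℕ.m<1+n⇒m<n∨m≡n i<1+k
    ... | inj₁ i<k  = done i i<k
    ... | inj₂ refl = trans (todo k ℕ.≤-refl) (sym eq)
    recent′ : ∀ i → i ℕ.< suc k → suc k ℕ.≤ 2 + i → σ i ≡ ε ‼ i ⊎ last ≡ just (ε ‼ i)
    recent′ i i<1+k k<2+i with ℕ.m<1+n⇒m<n∨m≡n i<1+k
    ... | inj₁ i<k  = recent i i<k (ℕ.<⇒≤ k<2+i)
    ... | inj₂ refl = inj₁ eq

  -- Overwriting `last` loses nothing: position `k` is unmoved, and the new value of `last` is the
  -- original entry at `suc k`.
  Inv-changed : ∀ {k seq last x} (i : Fin n) → toℕ i ≡ suc k → σ k ≡ ε ‼ k → x ≡ σ (suc k) →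
    Inv (suc k) (mkState seq last) → Inv (2 + k) (mkState (seq [ i ]≔ x) (just (lookup seq i)))
  Inv-changed {k} {seq} {last} {x} i i≡ eq x≡ inv = record
    { done   = done′
    ; todo   = λ l k<l → trans (‼-minimal seq i l (λ l≡ → ℕ.<⇒≢ k<l (sym (trans l≡ i≡))))
                               (todo l (ℕ.<⇒≤ k<l))
    ; recent = recent′
    }
    where
    open Inv inv
    done′ : ∀ l → l ℕ.< 2 + k → (seq [ i ]≔ x) ‼ l ≡ σ l
    done′ l l<2+k with ℕ.m<1+n⇒m<n∨m≡n l<2+k
    ... | inj₁ l<1+k = trans (‼-minimal seq i l (λ l≡ → ℕ.<⇒≢ l<1+k (trans l≡ i≡))) (done l l<1+k)
    ... | inj₂ refl  = trans (subst (λ m → (seq [ i ]≔ x) ‼ m ≡ x) i≡ (‼-updated seq i)) x≡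
    recent′ : ∀ l → l ℕ.< 2 + k → 2 + k ℕ.≤ 2 + l →
      σ l ≡ ε ‼ l ⊎ just (lookup seq i) ≡ just (ε ‼ l)
    recent′ l l<2+k (s≤s (s≤s k≤l)) with ℕ.m<1+n⇒m<n∨m≡n l<2+k
    ... | inj₂ refl  = inj₂ (cong just (trans (lookup-‼ seq i)
                              (trans (cong (seq ‼_) i≡) (todo l ℕ.≤-refl))))
    -- The bounds leave only `l ≡ k`.
    ... | inj₁ l<1+k with refl ← ℕ.≤-antisym k≤l (ℕ.m<1+n⇒m≤n l<1+k) = inj₁ eq

  step-Inv : ∀ i s → Inv (toℕ i) s → ∃[ s′ ] (step ε i s ≡ just s′ × Inv (suc (toℕ i)) s′)
  step-Inv zero       s inv = s , refl , Inv-kept refl inv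
  step-Inv (suc zero) s inv = s , refl , Inv-kept refl inv
  step-Inv (suc (suc i)) (mkState seq last) inv = go (branch j)
    where
    open Inv inv
    j = toℕ i

    seq-j : seq ‼ j ≡ σ j
    seq-j = done j (ℕ.m<n⇒m<1+n (ℕ.n<1+n j))
    seq-1+j : seq ‼ (1 + j) ≡ σ (1 + j)
    seq-1+j = done (1 + j) (ℕ.n<1+n (1 + j))
    seq-2+j : seq ‼ (2 + j) ≡ ε ‼ (2 + j)
    seq-2+j = todo (2 + j) ℕ.≤-refl
    seq-3+j : seq ‼ (3 + j) ≡ ε ‼ (3 + j)
    seq-3+j = todo (3 + j) (ℕ.n≤1+n (2 + j))

    pred₁ : lookup seq (inject₁ (suc i)) ≡ σ (1 + j)
    pred₁ = trans (lookup-‼ seq _) (trans (cong (seq ‼_) (toℕ-inject₁ (suc i))) seq-1+j)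

    pred₂ : lookup seq (inject₁ (inject₁ i)) ≡ σ j
    pred₂ = trans (lookup-‼ seq _)
      (trans (cong (seq ‼_) (trans (toℕ-inject₁ (inject₁ i)) (toℕ-inject₁ i))) seq-j)

    -- In this window the current sequence agrees with `σ` at the first two entries and with `ε` at
    -- the last two.
    N⇔ : (Em p seq j ⊎ Em q seq j) ⇔ N j (σ j) (σ (1 + j))
    N⇔ rewrite sym seq-j | sym seq-1+j | sym seq-2+j | sym seq-3+j = Em-p seq j ⊎-⇔ Em-q seq j

    go : Branch j (σ j) (σ (1 + j)) (σ (2 + j)) →
      ∃[ s′ ] (step ε (suc (suc i)) (mkState seq last) ≡ just s′ × Inv (3 + j) s′)
    go (atP Pe z≡)
      rewrite dec-true (Em? p ε j) (from (Em-p ε j) Pe) =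
      _ , refl , Inv-changed (suc (suc i)) refl (fixed j (inj₁ (proj₁ (proj₂ Pe))))
        (trans pred₁ (sym z≡)) inv
    go (atQ ¬Pe Qe z≡)
      rewrite dec-false (Em? p ε j) (¬Pe ∘ to (Em-p ε j))
            | dec-true (Em? q ε j) (from (Em-q ε j) Qe) =
      _ , refl , Inv-changed (suc (suc i)) refl (fixed j (inj₁ (proj₁ (proj₂ Qe))))
        (trans pred₂ (sym z≡)) inv
    go (swap ¬Pe ¬Qe Nj z≡)
      rewrite dec-false (Em? p ε j) (¬Pe ∘ to (Em-p ε j))
            | dec-false (Em? q ε j) (¬Qe ∘ to (Em-q ε j))
            | dec-true (Em? p seq j ⊎-dec Em? q seq j) (from N⇔ Nj)
      -- By `swap-moved` position `j` has moved, so `last` is not null and holds the original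
      -- `ε ‼ j`.
      with recent j (ℕ.m<n⇒m<1+n (ℕ.n<1+n j)) ℕ.≤-refl
    ... | inj₁ eq   = contradiction eq
      (proj₂ (proj₂ (proj₂ (swap-moved (local j) (local (1 + j)) ¬Pe ¬Qe Nj))))
    ... | inj₂ refl =
      _ , refl , Inv-changed (suc (suc i)) refl (fixed j (inj₂ (proj₁ (N-rises Nj)))) (sym z≡) inv
    go (keep ¬Pe ¬Qe ¬Nj z≡)
      rewrite dec-false (Em? p ε j) (¬Pe ∘ to (Em-p ε j))
            | dec-false (Em? q ε j) (¬Qe ∘ to (Em-q ε j))
            | dec-false (Em? p seq j ⊎-dec Em? q seq j) (¬Nj ∘ to N⇔) =
      _ , refl , Inv-kept z≡ inv

  run : ∃[ s ] (foldl (λ s i → s >>= step ε i) (just (mkState ε nothing)) (allFin n) ≡ just s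
              × Inv n s)
  -- That the state is never `nothing` is part of the invariant; `allFin n` is `tabulate id`.
  run = foldl-tabulate (λ k ms → ∃[ s ] (ms ≡ just s × Inv k s)) (λ s i → s >>= step ε i) id
    (λ { i (s , refl , inv) → step-Inv i s inv }) (_ , refl , Inv-start)

  output : ∃[ ε′ ] (algorithmA ε ≡ just ε′ × (∀ i → i ℕ.< n → ε′ ‼ i ≡ σ i))
  output with run
  ... | s , eq , inv = State.seq s , cong (Maybe.map State.seq) eq , Inv.done inv

-- Transfer to the output sequence.

-- The bound in `Occurs` places all four positions below `n`, where the functions agree.
Occurs-cong : ∀ A {n f g j} → (∀ i → i ℕ.< n → f i ≡ g i) → Occurs A n f j → Occurs A n g j
Occurs-cong A {j = j} f≡g (fits , occ)
  rewrite f≡g j       (ℕ.≤-trans (s≤s (ℕ.m≤n+m j 3)) fits)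
        | f≡g (1 + j) (ℕ.≤-trans (s≤s (s≤s (ℕ.m≤n+m j 2))) fits)
        | f≡g (2 + j) (ℕ.≤-trans (s≤s (s≤s (s≤s (ℕ.m≤n+m j 1)))) fits)
        | f≡g (3 + j) fits = fits , occ

theorem3 : (n : ℕ) (ε : Vec ℤ n) →
    ∃[ ε′ ] (algorithmA ε ≡ just ε′ × Em p ε ≐ Em q ε′ × Em q ε ≐ Em p ε′)
theorem3 n ε with Simulation.output ε
... | ε′ , run , agree = ε′ , run
  , ( (λ {j} → from (Em-q ε′ j) ∘ Occurs-cong Is0112 agree⁻¹ ∘ Pe⇒Qσ j ∘ to (Em-p ε j))
    , (λ {j} → from (Em-p ε j) ∘ Qσ⇒Pe j ∘ Occurs-cong Is0112 agree ∘ to (Em-q ε′ j)))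
  , ( (λ {j} → from (Em-p ε′ j) ∘ Occurs-cong Is0102 agree⁻¹ ∘ Qe⇒Pσ j ∘ to (Em-q ε j))
    , (λ {j} → from (Em-q ε j) ∘ Pσ⇒Qe j ∘ Occurs-cong Is0102 agree ∘ to (Em-p ε′ j)))
  where
  open Output n (ε ‼_)
  agree⁻¹ : ∀ i → i ℕ.< n → σ i ≡ ε′ ‼ i
  agree⁻¹ i i<n = sym (agree i i<n)
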